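{- Let $G_1,\dots,G_k$ be connected graphs, each with at least $2$ vertices. Then $$\gamma(G_1\times G_2\times\cdots\times G_k)=\frac{1}{\sum_{i=1}^k \frac{1}{\gamma(G_i)}}.$$
   Context: For a finite simple undirected graph $G$ with $n$ vertices, let $\mathcal{F}=\{x\in\mathbb{R}^{V(G)} : \sum_{v} x_v = 0,\ \|x\|_\infty = 1\}$, for $x\in\mathcal{F}$ let $\gamma_x(G)=\max_{uv\in E(G)}|x_u-x_v|$, and $\gamma(G)=\min_{x\in\mathcal{F}}\gamma_x(G)$. The Cartesian product $G_1\times\cdots\times G_k$ has vertex set $V(G_1)\times\cdots\times V(G_k)$, with $(u_1,\dots,u_k)\sim(v_1,\dots,v_k)$ iff there is exactly one index $i$ with $u_i\sim v_i$ in $G_i$ and $u_j=v_j$ for all $j\ne i$. -}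

module Defs where

open import Data.Fin.Base using (Fin; zero; suc)
import Data.Fin.Properties as Fin
open import Data.List.Base
  using (List; map; foldr; filter; tabulate; cartesianProduct)
open import Data.Nat.Base as ℕ using (ℕ; zero; suc)
import Data.Nat.Properties as ℕ
open import Data.Product.Base using (Σ; ∃; _×_; _,_; proj₁; proj₂; uncurry)
open import Data.Product using (∃!)
open import Data.Product.Function.NonDependent.Propositional using (_×-↔_)
open import Data.Rational.Base as ℚ using (ℚ; 0ℚ; 1ℚ; ½)
import Data.Rational.Properties as ℚ
open import Data.Rational.Solver using (module +-*-Solver)
open import Data.Sum.Base using (inj₁; inj₂)
open import Data.Unit.Base using (⊤)
open import Function.Base using (_∘_)
open import Function.Bundles using (_↔_; Inverse)
open import Function.Construct.Composition using (_↔-∘_)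
open import Function.Construct.Symmetry using (↔-sym)
open import Function.Properties.Inverse using (↔⇒↣)
open import Relation.Binary.Construct.Closure.ReflexiveTransitive using (Star)
open import Relation.Binary.Definitions
  using (Decidable; DecidableEquality; Symmetric)
open import Relation.Binary.PropositionalEquality
  using (_≡_; _≢_; refl; sym; trans; cong; cong₂; subst; subst₂)
open import Relation.Nullary.Decidable
  using (yes; no; map′; ¬?; _×-dec_; _→-dec_; via-injection)
open import Relation.Nullary.Negation using (¬_; contradiction)

------------------------------------------------------------------------
-- Inequalities between rationals

dist-sym : ∀ p q → ℚ.∣ p ℚ.- q ∣ ≡ ℚ.∣ q ℚ.- p ∣
dist-sym p q = trans (sym (ℚ.∣-p∣≡∣p∣ (p ℚ.- q))) (cong ℚ.∣_∣
  (solve 2 (λ p q → :- (p :- q) := q :- p) refl p q))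
  where open +-*-Solver

dist-neg : ∀ p q → ℚ.∣ (ℚ.- p) ℚ.- (ℚ.- q) ∣ ≡ ℚ.∣ p ℚ.- q ∣
dist-neg p q = trans (cong ℚ.∣_∣
  (solve 2 (λ p q → (:- p) :- (:- q) := q :- p) refl p q)) (dist-sym q p)
  where open +-*-Solver

p≤∣p∣ : ∀ p → p ℚ.≤ ℚ.∣ p ∣
p≤∣p∣ p with ℚ.≤-total 0ℚ p
... | inj₁ 0≤p = ℚ.≤-reflexive (sym (ℚ.0≤p⇒∣p∣≡p 0≤p))
... | inj₂ p≤0 = ℚ.≤-trans p≤0 (ℚ.0≤∣p∣ p)

≤+dist : ∀ p q → p ℚ.≤ q ℚ.+ ℚ.∣ p ℚ.- q ∣
≤+dist p q = subst (ℚ._≤ q ℚ.+ ℚ.∣ p ℚ.- q ∣)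
  (solve 2 (λ p q → q :+ (p :- q) := p) refl p q)
  (ℚ.+-monoʳ-≤ q (p≤∣p∣ (p ℚ.- q)))
  where open +-*-Solver

<+⇒-< : ∀ {p q ε} → p ℚ.< q ℚ.+ ε → p ℚ.- q ℚ.< ε
<+⇒-< {p} {q} {ε} p<q+ε = subst (p ℚ.- q ℚ.<_)
  (solve 2 (λ q ε → (q :+ ε) :- q := ε) refl q ε)
  (ℚ.+-monoˡ-< (ℚ.- q) p<q+ε)
  where open +-*-Solver

near⇒< : ∀ {p q ε} → ℚ.∣ p ℚ.- q ∣ ℚ.< ε → p ℚ.< q ℚ.+ ε
near⇒< {p} {q} d = ℚ.≤-<-trans (≤+dist p q) (ℚ.+-monoʳ-< q d)

<⇒near : ∀ {p q ε} → p ℚ.< q ℚ.+ ε → q ℚ.< p ℚ.+ ε → ℚ.∣ p ℚ.- q ∣ ℚ.< ε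
<⇒near {p} {q} {ε} p<q+ε q<p+ε with ℚ.∣p∣≡p∨∣p∣≡-p (p ℚ.- q)
... | inj₁ eq = subst (ℚ._< ε) (sym eq) (<+⇒-< p<q+ε)
... | inj₂ eq = subst (ℚ._< ε)
  (sym (trans eq (solve 2 (λ p q → :- (p :- q) := q :- p) refl p q)))
  (<+⇒-< q<p+ε)
  where open +-*-Solver

near-∣∣ : ∀ {p q ε} → ℚ.∣ p ℚ.- q ∣ ℚ.< ε → ℚ.∣ ℚ.∣ p ∣ ℚ.- ℚ.∣ q ∣ ∣ ℚ.< ε
near-∣∣ {p} {q} {ε} d = <⇒near (half p q d) (half q p (subst (ℚ._< ε) (dist-sym p q) d))
  where
  open +-*-Solver
  half : ∀ p q → ℚ.∣ p ℚ.- q ∣ ℚ.< ε → ℚ.∣ p ∣ ℚ.< ℚ.∣ q ∣ ℚ.+ ε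
  half p q d = ℚ.≤-<-trans
    (subst (λ r → ℚ.∣ r ∣ ℚ.≤ ℚ.∣ q ∣ ℚ.+ ℚ.∣ p ℚ.- q ∣)
      (solve 2 (λ p q → q :+ (p :- q) := p) refl p q)
      (ℚ.∣p+q∣≤∣p∣+∣q∣ q (p ℚ.- q)))
    (ℚ.+-monoʳ-< ℚ.∣ q ∣ d)

⊔-< : ∀ {p q r} → p ℚ.< r → q ℚ.< r → p ℚ.⊔ q ℚ.< r
⊔-< {p} {q} {r} p<r q<r with ℚ.≤-total p q
... | inj₁ p≤q = subst (ℚ._< r) (sym (ℚ.p≤q⇒p⊔q≡q p≤q)) q<r
... | inj₂ q≤p = subst (ℚ._< r) (sym (ℚ.p≥q⇒p⊔q≡p q≤p)) p<r

near-⊔ : ∀ {p p′ q q′ ε} → ℚ.∣ p ℚ.- p′ ∣ ℚ.< ε → ℚ.∣ q ℚ.- q′ ∣ ℚ.< ε →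
         ℚ.∣ (p ℚ.⊔ q) ℚ.- (p′ ℚ.⊔ q′) ∣ ℚ.< ε
near-⊔ {p} {p′} {q} {q′} {ε} d e = <⇒near (half p p′ q q′ d e)
  (half p′ p q′ q (subst (ℚ._< ε) (dist-sym p p′) d) (subst (ℚ._< ε) (dist-sym q q′) e))
  where
  half : ∀ p p′ q q′ → ℚ.∣ p ℚ.- p′ ∣ ℚ.< ε → ℚ.∣ q ℚ.- q′ ∣ ℚ.< ε →
         p ℚ.⊔ q ℚ.< (p′ ℚ.⊔ q′) ℚ.+ ε
  half p p′ q q′ d e = ⊔-<
    (ℚ.<-≤-trans (near⇒< {p} {p′} d) (ℚ.+-monoˡ-≤ ε (ℚ.p≤p⊔q p′ q′)))
    (ℚ.<-≤-trans (near⇒< {q} {q′} e) (ℚ.+-monoˡ-≤ ε (ℚ.p≤q⊔p p′ q′)))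

halves : ∀ ε → ½ ℚ.* ε ℚ.+ ½ ℚ.* ε ≡ ε
halves ε = trans (sym (ℚ.*-distribʳ-+ ε ½ ½)) (ℚ.*-identityˡ ε)

half-pos : ∀ {ε} → 0ℚ ℚ.< ε → 0ℚ ℚ.< ½ ℚ.* ε
half-pos {ε} 0<ε = subst (ℚ._< ½ ℚ.* ε) (ℚ.*-zeroʳ ½) (ℚ.*-monoʳ-<-pos ½ 0<ε)

near-+ : ∀ {p p′ q q′ ε} →
         ℚ.∣ p ℚ.- p′ ∣ ℚ.< ½ ℚ.* ε → ℚ.∣ q ℚ.- q′ ∣ ℚ.< ½ ℚ.* ε →
         ℚ.∣ (p ℚ.+ q) ℚ.- (p′ ℚ.+ q′) ∣ ℚ.< ε
near-+ {p} {p′} {q} {q′} {ε} d e = ℚ.≤-<-trans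
  (subst (λ r → ℚ.∣ r ∣ ℚ.≤ ℚ.∣ p ℚ.- p′ ∣ ℚ.+ ℚ.∣ q ℚ.- q′ ∣)
    (solve 4 (λ p p′ q q′ → (p :- p′) :+ (q :- q′) := (p :+ q) :- (p′ :+ q′))
      refl p p′ q q′)
    (ℚ.∣p+q∣≤∣p∣+∣q∣ (p ℚ.- p′) (q ℚ.- q′)))
  (subst (ℚ.∣ p ℚ.- p′ ∣ ℚ.+ ℚ.∣ q ℚ.- q′ ∣ ℚ.<_) (halves ε) (ℚ.+-mono-< d e))
  where open +-*-Solver

recip : ℚ → ℚ
recip q with q ℚ.≟ 0ℚ
... | yes _   = 0ℚ
... | no  q≢0 = (ℚ.1/ q) {{ℚ.≢-nonZero q≢0}}

recip-inverse : ∀ q → q ≢ 0ℚ → q ℚ.* recip q ≡ 1ℚ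
recip-inverse q q≢0 with q ℚ.≟ 0ℚ
... | yes q≡0 = contradiction q≡0 q≢0
... | no  q≢0 = ℚ.*-inverseʳ q {{ℚ.≢-nonZero q≢0}}

*-pos : ∀ {p q} → 0ℚ ℚ.< p → 0ℚ ℚ.< q → 0ℚ ℚ.< p ℚ.* q
*-pos {p} {q} 0<p 0<q = subst (ℚ._< p ℚ.* q) (ℚ.*-zeroʳ p)
  (ℚ.*-monoʳ-<-pos p {{ℚ.positive 0<p}} 0<q)

near-recip : ∀ {p q δ ε} → 0ℚ ℚ.< δ → 0ℚ ℚ.< ε → δ ℚ.≤ ℚ.∣ p ∣ → δ ℚ.≤ ℚ.∣ q ∣ →
             ℚ.∣ p ℚ.- q ∣ ℚ.< ε ℚ.* (δ ℚ.* δ) →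
             ℚ.∣ recip p ℚ.- recip q ∣ ℚ.< ε
near-recip {p} {q} {δ} {ε} 0<δ 0<ε δ≤∣p∣ δ≤∣q∣ d =
  ℚ.*-cancelʳ-<-nonNeg (ℚ.∣ p ∣ ℚ.* ℚ.∣ q ∣) {{nonNeg}}
    (ℚ.<-≤-trans (subst (ℚ._< ε ℚ.* (δ ℚ.* δ)) (sym numerators) d) δδ≤)
  where
  open +-*-Solver

  ≢0 : ∀ {r} → δ ℚ.≤ ℚ.∣ r ∣ → r ≢ 0ℚ
  ≢0 δ≤ refl = ℚ.<-irrefl refl (ℚ.<-≤-trans 0<δ δ≤)

  nonNeg : ℚ.NonNegative (ℚ.∣ p ∣ ℚ.* ℚ.∣ q ∣)
  nonNeg = subst ℚ.NonNegative (ℚ.∣p*q∣≡∣p∣*∣q∣ p q) (ℚ.∣-∣-nonNeg (p ℚ.* q))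

  difference : (recip p ℚ.- recip q) ℚ.* (p ℚ.* q) ≡ q ℚ.- p
  difference = trans
    (solve 4 (λ p q a b → (a :- b) :* (p :* q) := (p :* a) :* q :- (q :* b) :* p)
      refl p q (recip p) (recip q))
    (cong₂ ℚ._-_
      (trans (cong (ℚ._* q) (recip-inverse p (≢0 δ≤∣p∣))) (ℚ.*-identityˡ q))
      (trans (cong (ℚ._* p) (recip-inverse q (≢0 δ≤∣q∣))) (ℚ.*-identityˡ p)))

  numerators : ℚ.∣ recip p ℚ.- recip q ∣ ℚ.* (ℚ.∣ p ∣ ℚ.* ℚ.∣ q ∣) ≡ ℚ.∣ p ℚ.- q ∣
  numerators = trans
    (cong (ℚ.∣ recip p ℚ.- recip q ∣ ℚ.*_) (sym (ℚ.∣p*q∣≡∣p∣*∣q∣ p q)))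
    (trans (sym (ℚ.∣p*q∣≡∣p∣*∣q∣ (recip p ℚ.- recip q) (p ℚ.* q)))
      (trans (cong ℚ.∣_∣ difference) (dist-sym q p)))

  δδ≤ : ε ℚ.* (δ ℚ.* δ) ℚ.≤ ε ℚ.* (ℚ.∣ p ∣ ℚ.* ℚ.∣ q ∣)
  δδ≤ = ℚ.*-monoˡ-≤-nonNeg ε {{ℚ.nonNegative (ℚ.<⇒≤ 0<ε)}}
    (ℚ.≤-trans
      (ℚ.*-monoʳ-≤-nonNeg δ {{ℚ.nonNegative (ℚ.<⇒≤ 0<δ)}} δ≤∣p∣)
      (ℚ.*-monoˡ-≤-nonNeg ℚ.∣ p ∣ {{ℚ.∣-∣-nonNeg p}} δ≤∣q∣))

------------------------------------------------------------------------
-- Real numbers: Cauchy sequences of rationals, identified by the setoid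
-- equality _≃_

Eventually : (ℕ → Set) → Set
Eventually P = ∃ λ N → ∀ n → N ℕ.≤ n → P n

record ℝ : Set where
  field
    seq    : ℕ → ℚ
    cauchy : ∀ ε → 0ℚ ℚ.< ε →
             ∃ λ N → ∀ m n → N ℕ.≤ m → N ℕ.≤ n → ℚ.∣ seq m ℚ.- seq n ∣ ℚ.< ε

open ℝ public

infix  4 _≃_ _≤_
infixl 6 _+_ _-_
infixl 6 _⊔_
infix  8 -_

_≃_ : ℝ → ℝ → Set
x ≃ y = ∀ ε → 0ℚ ℚ.< ε → Eventually λ n → ℚ.∣ seq x n ℚ.- seq y n ∣ ℚ.< ε

-- The slack ε is what makes this the order on limits: it is respected by
-- _≃_, unlike eventual termwise comparison.
_≤_ : ℝ → ℝ → Set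
x ≤ y = ∀ ε → 0ℚ ℚ.< ε → Eventually λ n → seq x n ℚ.< seq y n ℚ.+ ε

fromℚ : ℚ → ℝ
fromℚ q = record
  { seq    = λ _ → q
  ; cauchy = λ ε 0<ε → 0 , λ _ _ _ _ →
      subst (ℚ._< ε) (sym (cong ℚ.∣_∣ (ℚ.+-inverseʳ q))) 0<ε
  }

0ℝ 1ℝ : ℝ
0ℝ = fromℚ 0ℚ
1ℝ = fromℚ 1ℚ

_+_ : ℝ → ℝ → ℝ
x + y = record
  { seq    = λ n → seq x n ℚ.+ seq y n
  ; cauchy = λ ε 0<ε →
      let M , f = cauchy x (½ ℚ.* ε) (half-pos 0<ε)
          N , g = cauchy y (½ ℚ.* ε) (half-pos 0<ε)
      in M ℕ.⊔ N , λ m n M⊔N≤m M⊔N≤n → near-+ {seq x m} {seq x n} {seq y m} {seq y n} {ε}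
           (f m n (ℕ.m⊔n≤o⇒m≤o M N M⊔N≤m) (ℕ.m⊔n≤o⇒m≤o M N M⊔N≤n))
           (g m n (ℕ.m⊔n≤o⇒n≤o M N M⊔N≤m) (ℕ.m⊔n≤o⇒n≤o M N M⊔N≤n))
  }

-_ : ℝ → ℝ
- x = record
  { seq    = λ n → ℚ.- seq x n
  ; cauchy = λ ε 0<ε →
      let N , f = cauchy x ε 0<ε
      in N , λ m n N≤m N≤n →
           subst (ℚ._< ε) (sym (dist-neg (seq x m) (seq x n))) (f m n N≤m N≤n)
  }

_-_ : ℝ → ℝ → ℝ
x - y = x + (- y)

∣_∣ : ℝ → ℝ
∣ x ∣ = record
  { seq    = λ n → ℚ.∣ seq x n ∣
  ; cauchy = λ ε 0<ε →
      let N , f = cauchy x ε 0<ε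
      in N , λ m n N≤m N≤n → near-∣∣ {seq x m} {seq x n} (f m n N≤m N≤n)
  }

_⊔_ : ℝ → ℝ → ℝ
x ⊔ y = record
  { seq    = λ n → seq x n ℚ.⊔ seq y n
  ; cauchy = λ ε 0<ε →
      let M , f = cauchy x ε 0<ε
          N , g = cauchy y ε 0<ε
      in M ℕ.⊔ N , λ m n M⊔N≤m M⊔N≤n → near-⊔ {seq x m} {seq x n} {seq y m} {seq y n}
           (f m n (ℕ.m⊔n≤o⇒m≤o M N M⊔N≤m) (ℕ.m⊔n≤o⇒m≤o M N M⊔N≤n))
           (g m n (ℕ.m⊔n≤o⇒n≤o M N M⊔N≤m) (ℕ.m⊔n≤o⇒n≤o M N M⊔N≤n))
  }

-- Apartness from zero, the constructive form of x ≠ 0 under which x has a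
-- reciprocal.
Apart₀ : ℝ → Set
Apart₀ x = ∃ λ δ → 0ℚ ℚ.< δ × Eventually λ n → δ ℚ.≤ ℚ.∣ seq x n ∣

-- The finitely many terms that may vanish are sent to 0.
1/ : (x : ℝ) → Apart₀ x → ℝ
1/ x (δ , 0<δ , M , away) = record
  { seq    = λ n → recip (seq x n)
  ; cauchy = λ ε 0<ε →
      let N , f = cauchy x (ε ℚ.* (δ ℚ.* δ)) (*-pos 0<ε (*-pos 0<δ 0<δ))
      in M ℕ.⊔ N , λ m n M⊔N≤m M⊔N≤n → near-recip {seq x m} {seq x n} 0<δ 0<ε
           (away m (ℕ.m⊔n≤o⇒m≤o M N M⊔N≤m)) (away n (ℕ.m⊔n≤o⇒m≤o M N M⊔N≤n))
           (f m n (ℕ.m⊔n≤o⇒n≤o M N M⊔N≤m) (ℕ.m⊔n≤o⇒n≤o M N M⊔N≤n))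
  }

sum : List ℝ → ℝ
sum = foldr _+_ 0ℝ

-- Only applied to lists of absolute values, so the 0 contributes nothing
-- unless the list is empty.
max : List ℝ → ℝ
max = foldr _⊔_ 0ℝ

IsMinimum : {A : Set} → (A → Set) → (A → ℝ) → ℝ → Set
IsMinimum P f m = (∃ λ x → P x × f x ≃ m) × (∀ x → P x → m ≤ f x)

------------------------------------------------------------------------
-- Finite simple graphs

record Graph : Set₁ where
  infix 4 _∼_ _∼?_
  field
    V      : Set
    order  : ℕ
    finite : V ↔ Fin order
    _∼_    : V → V → Set
    _∼?_   : Decidable _∼_
    ∼-sym  : Symmetric _∼_
    ∼-irr  : ∀ {v} → ¬ v ∼ v

  _≟_ : DecidableEquality V
  _≟_ = via-injection (↔⇒↣ finite) Fin._≟_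

  vertices : List V
  vertices = tabulate (Inverse.from finite)

  -- each edge is listed in both orientations
  edges : List (V × V)
  edges = filter (uncurry _∼?_) (cartesianProduct vertices vertices)

  Connected : Set
  Connected = ∀ u v → Star _∼_ u v

  ‖_‖∞ : (V → ℝ) → ℝ
  ‖ x ‖∞ = max (map (λ v → ∣ x v ∣) vertices)

  ℱ : (V → ℝ) → Set
  ℱ x = sum (map x vertices) ≃ 0ℝ × ‖ x ‖∞ ≃ 1ℝ

  γ[_] : (V → ℝ) → ℝ
  γ[ x ] = max (map (λ (u , v) → ∣ x u - x v ∣) edges)

  -- "γ(G) = c"
  Isγ : ℝ → Set
  Isγ c = IsMinimum ℱ γ[_] c

open Graph public using (V; order; Connected; Isγ)

------------------------------------------------------------------------
-- Cartesian products

-- Tuples rather than dependent functions, so that tuples with equal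
-- components are propositionally equal.
Tuple : ∀ {k} → (Fin k → Set) → Set
Tuple {zero}  A = ⊤
Tuple {suc k} A = A zero × Tuple (A ∘ suc)

infixl 9 _!_

_!_ : ∀ {k} {A : Fin k → Set} → Tuple A → ∀ i → A i
(a , _)  ! zero  = a
(_ , as) ! suc i = as ! i

∏ : ∀ {k} → (Fin k → ℕ) → ℕ
∏ {zero}  n = 1
∏ {suc k} n = n zero ℕ.* ∏ (n ∘ suc)

Tuple↔ : ∀ {k} {A : Fin k → Set} {n : Fin k → ℕ} →
         (∀ i → A i ↔ Fin (n i)) → Tuple A ↔ Fin (∏ n)
Tuple↔ {zero}  f = ↔-sym Fin.1↔⊤
Tuple↔ {suc k} f = ↔-sym Fin.*↔× ↔-∘ (f zero ×-↔ Tuple↔ (f ∘ suc))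

module _ {k} (G : Fin k → Graph) where
  open Graph

  AdjacentAt : (u v : Tuple (V ∘ G)) → Fin k → Set
  AdjacentAt u v i = _∼_ (G i) (u ! i) (v ! i) × (∀ j → j ≢ i → u ! j ≡ v ! j)

  private
    unique : ∀ u v {i j} → AdjacentAt u v i → AdjacentAt u v j → i ≡ j
    unique u v {i} {j} (i∼ , _) (_ , j=) with i Fin.≟ j
    ... | yes i≡j = i≡j
    ... | no  i≢j = contradiction
      (subst (λ w → _∼_ (G i) w (v ! i)) (j= i i≢j) i∼) (∼-irr (G i))

    flip : ∀ u v {i} → AdjacentAt u v i → AdjacentAt v u i
    flip u v {i} (i∼ , i=) = ∼-sym (G i) i∼ , λ j j≢i → sym (i= j j≢i)

  □ : Graph
  □ .V      = Tuple (V ∘ G)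
  □ .order  = ∏ (order ∘ G)
  □ .finite = Tuple↔ (finite ∘ G)
  □ ._∼_ u v = ∃! _≡_ (AdjacentAt u v)
  □ ._∼?_ u v = map′
    (λ (i , a) → i , a , unique u v a)
    (λ (i , a , _) → i , a)
    (Fin.any? λ i → _∼?_ (G i) (u ! i) (v ! i)
      ×-dec Fin.all? λ j → ¬? (j Fin.≟ i) →-dec _≟_ (G j) (u ! j) (v ! j))
  □ .∼-sym {u} {v} (i , a , i!) = i , flip u v a , λ b → i! (flip v u b)
  □ .∼-irr (i , (i∼ , _) , _) = ∼-irr (G i) i∼

{-# OPTIONS --safe #-}

-- γ(G) is the reciprocal of μ(G), the largest mean distance from a vertex of G.
-- If x has sum 0 and varies by at most c along edges, then
-- n |x v| = |Σ_u (x v - x u)| ≤ c Σ_u d(u,v) ≤ c n μ for all v, so ‖x‖∞ = 1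
-- forces 1 ≤ c μ. Conversely, let v attain μ. Then x u = d(v,u)/μ - 1 has sum 0
-- and x v = -1, and it stays ≤ 1 because averaging d(v,w) ≤ d(v,u) + d(w,u) over
-- u gives d(v,w) ≤ 2μ. In a Cartesian product distances add up coordinatewise,
-- hence so do their means and the maxima of these.
module Submission where

open import Defs
open import Algebra.Bundles using (CommutativeRing)
import Algebra.Properties.Semiring.Mult as SemiringMult
import Algebra.Properties.Semiring.Sum as SemiringSum
open import Data.Fin.Base using (Fin; zero; suc; _↑ˡ_; _↑ʳ_; combine; remQuot)
import Data.Fin.Properties as Fin
open import Data.List.Base using ([]; _∷_; map; tabulate; cartesianProduct)
open import Data.List.Membership.Propositional using (_∈_)
import Data.List.Membership.Propositional.Properties as ∈
open import Data.List.Relation.Unary.All using (All; []; _∷_)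
import Data.List.Relation.Unary.All as All
import Data.List.Relation.Unary.All.Properties as All
open import Data.List.Relation.Unary.Any using (here; there)
open import Data.Nat.Base as ℕ using (ℕ; NonZero; zero; suc; z≤n; s≤s)
import Data.Nat.Properties as ℕ
open import Data.Product using (Σ-syntax; ∃; _×_; _,_; proj₁; proj₂; uncurry)
open import Data.Rational.Base as ℚ using (ℚ; 0ℚ; 1ℚ; ½)
import Data.Rational.Properties as ℚ
open import Relation.Binary.Bundles using (DecTotalOrder)
open import Data.List.Extrema (DecTotalOrder.totalOrder ℚ.≤-decTotalOrder)
  using (argmax; f[xs]≤f[argmax])
open import Data.Rational.Solver using (module +-*-Solver)
open import Data.Sum.Base using (inj₁; inj₂)
open import Data.Unit.Base using (tt)
open import Function.Base using (_∘_)
open import Function.Bundles using (Inverse)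
open import Relation.Binary.Construct.Closure.ReflexiveTransitive using (Star; _◅_)
open import Relation.Binary.PropositionalEquality
  using (_≡_; _≢_; refl; sym; trans; cong; cong₂; subst; subst₂)
open import Relation.Nullary.Decidable using (Dec; yes; no; map′; _×-dec_)
open import Relation.Nullary.Negation using (contradiction)
open +-*-Solver using (solve; _:+_; _:*_; _:-_; :-_; _:=_; con)

-- Natural numbers, inequalities and reciprocals in the rationals.

private
  ℚ-semiring = CommutativeRing.semiring ℚ.+-*-commutativeRing
  module Mult = SemiringMult ℚ-semiring
  module ∑ = SemiringSum ℚ-semiring

-- As an iterated sum of `1ℚ` this unfolds at `suc`, and the semiring lemmas make it additive and
-- multiplicative, as needed for distances and for `size`.
fromℕ : ℕ → ℚ
fromℕ n = n Mult.× 1ℚ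

0≤fromℕ : ∀ n → 0ℚ ℚ.≤ fromℕ n
0≤fromℕ zero    = ℚ.≤-refl
0≤fromℕ (suc n) = ℚ.+-mono-≤ (ℚ.nonNegative⁻¹ 1ℚ) (0≤fromℕ n)

1≤fromℕ-suc : ∀ n → 1ℚ ℚ.≤ fromℕ (suc n)
1≤fromℕ-suc n = ℚ.+-monoʳ-≤ 1ℚ (0≤fromℕ n)

fromℕ-mono : ∀ {m n} → m ℕ.≤ n → fromℕ m ℚ.≤ fromℕ n
fromℕ-mono {n = n} z≤n = 0≤fromℕ n
fromℕ-mono (s≤s m≤n) = ℚ.+-monoʳ-≤ 1ℚ (fromℕ-mono m≤n)

p-q≤r⇒∣p-q∣≤r : ∀ {p q r} → p ℚ.- q ℚ.≤ r → q ℚ.- p ℚ.≤ r → ℚ.∣ p ℚ.- q ∣ ℚ.≤ r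
p-q≤r⇒∣p-q∣≤r {p} {q} {r} p-q≤r q-p≤r with ℚ.∣p∣≡p∨∣p∣≡-p (p ℚ.- q)
... | inj₁ eq = subst (ℚ._≤ r) (sym eq) p-q≤r
... | inj₂ eq = subst (ℚ._≤ r)
  (sym (trans eq (solve 2 (λ p q → :- (p :- q) := q :- p) refl p q))) q-p≤r

p≤q+r⇒p-q≤r : ∀ {p q r} → p ℚ.≤ q ℚ.+ r → p ℚ.- q ℚ.≤ r
p≤q+r⇒p-q≤r {p} {q} {r} p≤q+r = subst (p ℚ.- q ℚ.≤_)
  (solve 2 (λ q r → (q :+ r) :- q := r) refl q r)
  (ℚ.+-monoˡ-≤ (ℚ.- q) p≤q+r)

0≤p+p⇒0≤p : ∀ {p} → 0ℚ ℚ.≤ p ℚ.+ p → 0ℚ ℚ.≤ p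
0≤p+p⇒0≤p {p} 0≤p+p with ℚ.≤-total 0ℚ p
... | inj₁ 0≤p = 0≤p
... | inj₂ p≤0 = ℚ.≤-trans 0≤p+p (subst (p ℚ.+ p ℚ.≤_) (ℚ.+-identityʳ p) (ℚ.+-monoʳ-≤ p p≤0))

recip-unique : ∀ {p q} → p ℚ.* q ≡ 1ℚ → recip p ≡ q
recip-unique {p} {q} pq≡1 = trans (sym (ℚ.*-identityʳ (recip p)))
  (trans (cong (recip p ℚ.*_) (sym pq≡1))
  (trans (solve 3 (λ r p q → r :* (p :* q) := (p :* r) :* q) refl (recip p) p q)
  (trans (cong (ℚ._* q) (recip-inverse p p≢0)) (ℚ.*-identityˡ q))))
  where
  p≢0 : p ≢ 0ℚ
  p≢0 refl = contradiction (trans (sym pq≡1) (ℚ.*-zeroˡ q)) ℚ.1≢0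

*-recip : ∀ {p} → 0ℚ ℚ.< p → p ℚ.* recip p ≡ 1ℚ
*-recip {p} 0<p = recip-inverse p (ℚ.<⇒≢ 0<p ∘ sym)

recip-pos : ∀ {p} → 0ℚ ℚ.< p → 0ℚ ℚ.< recip p
recip-pos {p} 0<p = ℚ.*-cancelˡ-<-nonNeg p {{ℚ.nonNegative (ℚ.<⇒≤ 0<p)}}
  (subst₂ ℚ._<_ (sym (ℚ.*-zeroʳ p)) (sym (*-recip 0<p)) (ℚ.positive⁻¹ 1ℚ))

-- Finite sums of rationals.

sum-const : ∀ n p → ∑.sum {n} (λ _ → p) ≡ fromℕ n ℚ.* p
sum-const n p = trans (∑.sum-replicate n)
  (trans (cong (n Mult.×_) (sym (ℚ.*-identityˡ p))) (sym (Mult.×-assoc-* n 1ℚ p)))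

sum-mono : ∀ {n} {f g : Fin n → ℚ} → (∀ i → f i ℚ.≤ g i) → ∑.sum f ℚ.≤ ∑.sum g
sum-mono {zero}  f≤g = ℚ.≤-refl
sum-mono {suc n} f≤g = ℚ.+-mono-≤ (f≤g zero) (sum-mono (f≤g ∘ suc))

∣sum∣≤ : ∀ {n} (f : Fin n → ℚ) → ℚ.∣ ∑.sum f ∣ ℚ.≤ ∑.sum (ℚ.∣_∣ ∘ f)
∣sum∣≤ {zero}  f = ℚ.≤-refl
∣sum∣≤ {suc n} f = ℚ.≤-trans (ℚ.∣p+q∣≤∣p∣+∣q∣ (f zero) (∑.sum (f ∘ suc)))
  (ℚ.+-monoʳ-≤ ℚ.∣ f zero ∣ (∣sum∣≤ (f ∘ suc)))

sum-nonNeg : ∀ {n} {f : Fin n → ℚ} → (∀ i → 0ℚ ℚ.≤ f i) → 0ℚ ℚ.≤ ∑.sum f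
sum-nonNeg {zero}  0≤f = ℚ.≤-refl
sum-nonNeg {suc n} 0≤f = ℚ.+-mono-≤ (0≤f zero) (sum-nonNeg (0≤f ∘ suc))

term≤sum : ∀ {n} {f : Fin n → ℚ} → (∀ i → 0ℚ ℚ.≤ f i) → ∀ i → f i ℚ.≤ ∑.sum f
term≤sum {f = f} 0≤f zero = subst (ℚ._≤ ∑.sum f) (ℚ.+-identityʳ (f zero))
  (ℚ.+-monoʳ-≤ (f zero) (sum-nonNeg (0≤f ∘ suc)))
term≤sum {f = f} 0≤f (suc i) = subst (ℚ._≤ ∑.sum f) (ℚ.+-identityˡ (f (suc i)))
  (ℚ.+-mono-≤ (0≤f zero) (term≤sum (0≤f ∘ suc) i))

sum-++ : ∀ m {n} (f : Fin (m ℕ.+ n) → ℚ) →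
         ∑.sum f ≡ ∑.sum (f ∘ (_↑ˡ n)) ℚ.+ ∑.sum (f ∘ (m ↑ʳ_))
sum-++ zero    f = sym (ℚ.+-identityˡ (∑.sum f))
sum-++ (suc m) f = trans (cong (f zero ℚ.+_) (sum-++ m (f ∘ suc)))
  (sym (ℚ.+-assoc (f zero) _ _))

-- `combine` is row-major: the first n indices form the row of `zero` and the others are shifted by
-- n, so `sum-++` splits off one row at a time.
sum-combine : ∀ m {n} (f : Fin (m ℕ.* n) → ℚ) →
              ∑.sum f ≡ ∑.sum (λ i → ∑.sum (λ j → f (combine {m} {n} i j)))
sum-combine zero        f = refl
sum-combine (suc m) {n} f = trans (sum-++ n f)
  (cong (∑.sum (f ∘ (_↑ˡ (m ℕ.* n))) ℚ.+_) (sum-combine m (f ∘ (n ↑ʳ_))))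

-- The vertices of a product are enumerated through `remQuot`; this turns a sum over them into an
-- iterated sum.
sum-remQuot : ∀ m {n} (f : Fin m × Fin n → ℚ) →
              ∑.sum (f ∘ remQuot {m} n) ≡ ∑.sum (λ i → ∑.sum (λ j → f (i , j)))
sum-remQuot m f = trans (sum-combine m _)
  (∑.sum-cong-≗ λ i → ∑.sum-cong-≗ λ j → cong f (Fin.remQuot-combine i j))

-- Order, equality and reciprocals of reals.

≤-pointwise : ∀ {x y} → (∀ n → seq x n ℚ.≤ seq y n) → x ≤ y
≤-pointwise {x} {y} x≤y ε 0<ε = 0 , λ n _ → ℚ.≤-<-trans (x≤y n)
  (subst (ℚ._< seq y n ℚ.+ ε) (ℚ.+-identityʳ (seq y n)) (ℚ.+-monoʳ-< (seq y n) 0<ε))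

≤-antisym : ∀ {x y} → x ≤ y → y ≤ x → x ≃ y
≤-antisym {x} {y} x≤y y≤x ε 0<ε =
  let M , f = x≤y ε 0<ε
      N , g = y≤x ε 0<ε
  in M ℕ.⊔ N , λ n M⊔N≤n → <⇒near {seq x n} {seq y n}
       (f n (ℕ.m⊔n≤o⇒m≤o M N M⊔N≤n)) (g n (ℕ.m⊔n≤o⇒n≤o M N M⊔N≤n))

≤-trans : ∀ {x y z} → x ≤ y → y ≤ z → x ≤ z
≤-trans {x} {y} {z} x≤y y≤z ε 0<ε =
  let M , f = x≤y (½ ℚ.* ε) (half-pos 0<ε)
      N , g = y≤z (½ ℚ.* ε) (half-pos 0<ε)
  in M ℕ.⊔ N , λ n M⊔N≤n → subst (seq x n ℚ.<_)
       (trans (ℚ.+-assoc (seq z n) (½ ℚ.* ε) (½ ℚ.* ε)) (cong (seq z n ℚ.+_) (halves ε)))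
       (ℚ.<-trans (f n (ℕ.m⊔n≤o⇒m≤o M N M⊔N≤n))
         (ℚ.+-monoˡ-< (½ ℚ.* ε) (g n (ℕ.m⊔n≤o⇒n≤o M N M⊔N≤n))))

≃-sym : ∀ {x y} → x ≃ y → y ≃ x
≃-sym {x} {y} x≃y ε 0<ε =
  let N , f = x≃y ε 0<ε
  in N , λ n N≤n → subst (ℚ._< ε) (dist-sym (seq x n) (seq y n)) (f n N≤n)

≃⇒≤ : ∀ {x y} → x ≃ y → x ≤ y
≃⇒≤ {x} {y} x≃y ε 0<ε =
  let N , f = x≃y ε 0<ε
  in N , λ n N≤n → near⇒< {seq x n} {seq y n} (f n N≤n)

≃-trans : ∀ {x y z} → x ≃ y → y ≃ z → x ≃ z
≃-trans {x} {y} {z} x≃y y≃z = ≤-antisym {x} {z}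
  (≤-trans {x} {y} {z} (≃⇒≤ {x} {y} x≃y) (≃⇒≤ {y} {z} y≃z))
  (≤-trans {z} {y} {x} (≃⇒≤ {z} {y} (≃-sym {y} {z} y≃z)) (≃⇒≤ {y} {x} (≃-sym {x} {y} x≃y)))

≃-pointwise : ∀ {x y} → (∀ n → seq x n ≡ seq y n) → x ≃ y
≃-pointwise {x} {y} x≡y = ≤-antisym {x} {y}
  (≤-pointwise {x} {y} λ n → ℚ.≤-reflexive (x≡y n))
  (≤-pointwise {y} {x} λ n → ℚ.≤-reflexive (sym (x≡y n)))

+-cong : ∀ {x x′ y y′} → x ≃ x′ → y ≃ y′ → x + y ≃ x′ + y′
+-cong {x} {x′} {y} {y′} x≃x′ y≃y′ ε 0<ε =
  let M , f = x≃x′ (½ ℚ.* ε) (half-pos 0<ε)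
      N , g = y≃y′ (½ ℚ.* ε) (half-pos 0<ε)
  in M ℕ.⊔ N , λ n M⊔N≤n →
       near-+ {seq x n} {seq x′ n} {seq y n} {seq y′ n} {ε}
         (f n (ℕ.m⊔n≤o⇒m≤o M N M⊔N≤n)) (g n (ℕ.m⊔n≤o⇒n≤o M N M⊔N≤n))

sum-tabulate-≃ : ∀ {k} {x : Fin k → ℝ} {q : Fin k → ℚ} → (∀ i → x i ≃ fromℚ (q i)) →
                 sum (tabulate x) ≃ fromℚ (∑.sum q)
sum-tabulate-≃ {zero}          x≃q = ≃-pointwise {0ℝ} {0ℝ} λ _ → refl
sum-tabulate-≃ {suc k} {x} {q} x≃q =
  +-cong {x zero} {fromℚ (q zero)} {sum (tabulate (x ∘ suc))} {fromℚ (∑.sum (q ∘ suc))}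
    (x≃q zero) (sum-tabulate-≃ (x≃q ∘ suc))

-- Closeness with tolerance `½ ℚ.* q` leaves the terms of x above `½ ℚ.* q`. This margin serves both
-- as apartness witness and as the δ of `near-recip`.
eventually-half≤ : ∀ {x q} → x ≃ fromℚ q → 0ℚ ℚ.< q →
                   Eventually λ n → ½ ℚ.* q ℚ.≤ ℚ.∣ seq x n ∣
eventually-half≤ {x} {q} x≃q 0<q =
  let N , f = ≃⇒≤ {fromℚ q} {x} (≃-sym {x} {fromℚ q} x≃q) (½ ℚ.* q) (half-pos 0<q)
  in N , λ n N≤n → ℚ.≤-trans
       (ℚ.<⇒≤ (subst (ℚ._< seq x n)
         (trans (cong (ℚ._- ½ ℚ.* q) (sym (halves q)))
           (solve 1 (λ h → (h :+ h) :- h := h) refl (½ ℚ.* q)))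
         (<+⇒-< {q} {½ ℚ.* q} (subst (q ℚ.<_) (ℚ.+-comm (seq x n) (½ ℚ.* q)) (f n N≤n)))))
       (p≤∣p∣ (seq x n))

≃pos⇒apart : ∀ {x q} → x ≃ fromℚ q → 0ℚ ℚ.< q → Apart₀ x
≃pos⇒apart {x} {q} x≃q 0<q = ½ ℚ.* q , half-pos 0<q , eventually-half≤ {x} x≃q 0<q

-- `1/` applies `recip` termwise whatever the witness, so an arbitrary proof of apartness is
-- allowed.
1/-≃ : ∀ {x q} → x ≃ fromℚ q → 0ℚ ℚ.< q → (x≠0 : Apart₀ x) → 1/ x x≠0 ≃ fromℚ (recip q)
1/-≃ {x} {q} x≃q 0<q x≠0 ε 0<ε =
  let 0<½q  = half-pos 0<q
      M , f = eventually-half≤ {x} x≃q 0<q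
      _ , h = eventually-half≤ {fromℚ q} (≃-pointwise {fromℚ q} {fromℚ q} λ _ → refl) 0<q
      -- `near-recip` asks for precision ε δ², here with δ = ½ q.
      N , g = x≃q (ε ℚ.* (½ ℚ.* q ℚ.* (½ ℚ.* q))) (*-pos 0<ε (*-pos 0<½q 0<½q))
  in M ℕ.⊔ N , λ n M⊔N≤n → near-recip {seq x n} {q} 0<½q 0<ε
       (f n (ℕ.m⊔n≤o⇒m≤o M N M⊔N≤n)) (h _ ℕ.≤-refl) (g n (ℕ.m⊔n≤o⇒n≤o M N M⊔N≤n))

-- Maxima, sums and minima of reals.

-- The fold defining `max` starts at 0, so an upper bound must also dominate 0.
max-≤ : ∀ {n b} xs → 0ℚ ℚ.≤ b → All (λ x → seq x n ℚ.≤ b) xs → seq (max xs) n ℚ.≤ b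
max-≤ []       0≤b []         = 0≤b
max-≤ (x ∷ xs) 0≤b (x≤b ∷ ≤b) = ℚ.⊔-lub x≤b (max-≤ xs 0≤b ≤b)

0≤max : ∀ {n} xs → 0ℚ ℚ.≤ seq (max xs) n
0≤max []           = ℚ.≤-refl
0≤max {n} (x ∷ xs) = ℚ.≤-trans (0≤max xs) (ℚ.p≤q⊔p (seq x n) _)

≤-max : ∀ {n x xs} → x ∈ xs → seq x n ℚ.≤ seq (max xs) n
≤-max {n} {xs = x ∷ xs} (here refl)  = ℚ.p≤p⊔q (seq x n) _
≤-max {n} {xs = x ∷ xs} (there x∈xs) = ℚ.≤-trans (≤-max x∈xs) (ℚ.p≤q⊔p (seq x n) _)

seq-sum : ∀ {A : Set} (x : A → ℝ) {m} (v : Fin m → A) n →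
          seq (sum (map x (tabulate v))) n ≡ ∑.sum (λ i → seq (x (v i)) n)
seq-sum x {zero}  v n = refl
seq-sum x {suc m} v n = cong (seq (x (v zero)) n ℚ.+_) (seq-sum x (v ∘ suc) n)

-- Each minimum is attained, and the other one bounds the attained value from below. This carries
-- results about one explicit value of γ over to any other.
IsMinimum-unique : ∀ {A : Set} {P : A → Set} {f : A → ℝ} {m m′} →
                   IsMinimum P f m → IsMinimum P f m′ → m ≃ m′
IsMinimum-unique {f = f} {m} {m′} ((x , Px , fx≃m) , m≤) ((y , Py , fy≃m′) , m′≤) =
  ≤-antisym {m} {m′}
    (≤-trans {m} {f y} {m′} (m≤ y Py) (≃⇒≤ {f y} {m′} fy≃m′))
    (≤-trans {m′} {f x} {m} (m′≤ x Px) (≃⇒≤ {f x} {m} fx≃m))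

IsMinimum-resp-≃ : ∀ {A : Set} {P : A → Set} {f : A → ℝ} {m m′} → m ≃ m′ →
                   IsMinimum P f m → IsMinimum P f m′
IsMinimum-resp-≃ {f = f} {m} {m′} m≃m′ ((x , Px , fx≃m) , m≤) =
  (x , Px , ≃-trans {f x} {m} {m′} fx≃m m≃m′) ,
  λ y Py → ≤-trans {m′} {m} {f y} (≃⇒≤ {m′} {m} (≃-sym {m} {m′} m≃m′)) (m≤ y Py)

-- Sums and norms over the vertices of a graph.

module _ (G : Graph) where
  open Graph G hiding (V; order; Connected; Isγ)

  size : ℚ
  size = fromℕ (order G)

  -- The summation follows the order of `vertices`, so `seq-sum` identifies it with the terms of the
  -- real sum in `ℱ`.
  total : (V G → ℚ) → ℚ
  total f = ∑.sum (f ∘ Inverse.from finite)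

  total-const : ∀ p → total (λ _ → p) ≡ size ℚ.* p
  total-const = sum-const (order G)

  total-cong : ∀ f g → (∀ v → f v ≡ g v) → total f ≡ total g
  total-cong f g f≡g = ∑.sum-cong-≗ {order G} (f≡g ∘ Inverse.from finite)

  total-mono : ∀ f g → (∀ v → f v ℚ.≤ g v) → total f ℚ.≤ total g
  total-mono f g f≤g = sum-mono {order G} (f≤g ∘ Inverse.from finite)

  total-+ : ∀ f g → total (λ v → f v ℚ.+ g v) ≡ total f ℚ.+ total g
  total-+ f g = ∑.∑-distrib-+ {order G} _ _

  total-* : ∀ c f → total (λ v → c ℚ.* f v) ≡ c ℚ.* total f
  total-* c f = sym (∑.*-distribˡ-sum {order G} c _)

  ∣total∣≤ : ∀ f → ℚ.∣ total f ∣ ℚ.≤ total (λ v → ℚ.∣ f v ∣)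
  ∣total∣≤ f = ∣sum∣≤ {order G} _

  1≤size : V G → 1ℚ ℚ.≤ size
  -- The index of v in `Fin (order G)` excludes order 0.
  1≤size v with order G | Inverse.to finite v
  ... | suc n | _ = 1≤fromℕ-suc n

  ∈-vertices : ∀ v → v ∈ vertices
  ∈-vertices v = subst (_∈ vertices) (Inverse.strictlyInverseʳ finite v)
    (∈.∈-tabulate⁺ (Inverse.to finite v))

  ∈-edges : ∀ {u v} → u ∼ v → (u , v) ∈ edges
  ∈-edges {u} {v} u∼v = ∈.∈-filter⁺ (uncurry _∼?_)
    (∈.∈-cartesianProduct⁺ (∈-vertices u) (∈-vertices v)) u∼v

  ≤-norm : ∀ x n v → ℚ.∣ seq (x v) n ∣ ℚ.≤ seq ‖ x ‖∞ n
  ≤-norm x n v = ≤-max (∈.∈-map⁺ (λ v → ∣ x v ∣) (∈-vertices v))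

  norm-≤ : ∀ x n {b} → 0ℚ ℚ.≤ b → (∀ v → ℚ.∣ seq (x v) n ∣ ℚ.≤ b) → seq ‖ x ‖∞ n ℚ.≤ b
  norm-≤ x n 0≤b ∣x∣≤b =
    max-≤ (map (λ v → ∣ x v ∣) vertices) 0≤b (All.map⁺ (All.universal ∣x∣≤b vertices))

  0≤γ : ∀ x n → 0ℚ ℚ.≤ seq γ[ x ] n
  0≤γ x n = 0≤max (map (λ (u , v) → ∣ x u - x v ∣) edges)

  ≤-γ : ∀ x n {u v} → u ∼ v → ℚ.∣ seq (x u) n ℚ.- seq (x v) n ∣ ℚ.≤ seq γ[ x ] n
  ≤-γ x n u∼v = ≤-max (∈.∈-map⁺ (λ (u , v) → ∣ x u - x v ∣) (∈-edges u∼v))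

  γ-≤ : ∀ x n {b} → 0ℚ ℚ.≤ b →
        (∀ {u v} → u ∼ v → ℚ.∣ seq (x u) n ℚ.- seq (x v) n ∣ ℚ.≤ b) → seq γ[ x ] n ℚ.≤ b
  γ-≤ x n 0≤b ∣x-x∣≤b = max-≤ (map (λ (u , v) → ∣ x u - x v ∣) edges) 0≤b
    (All.map⁺ (All.map ∣x-x∣≤b
      (All.all-filter (uncurry _∼?_) (cartesianProduct vertices vertices))))

  -- The largest mean distance from a vertex is μ, and it is attained at far.
  -- The fields adjacent and lipschitz pin d down as the shortest-walk metric;
  -- unlike a description by walks, they pass to products coordinatewise.
  record MaxMeanDistance (μ : ℚ) : Set where
    field
      d         : V G → V G → ℚ
      d-refl    : ∀ v → d v v ≡ 0ℚ
      triangle  : ∀ u v w → d v w ℚ.≤ d u v ℚ.+ d u w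
      adjacent  : ∀ {u v} → u ∼ v → d u v ℚ.≤ 1ℚ
      lipschitz : ∀ (f : V G → ℚ) c → (∀ {u v} → u ∼ v → ℚ.∣ f u ℚ.- f v ∣ ℚ.≤ c) →
                  ∀ u v → ℚ.∣ f u ℚ.- f v ∣ ℚ.≤ c ℚ.* d u v
      far       : V G
      total-far : total (d far) ≡ size ℚ.* μ
      total≤    : ∀ v → total (d v) ℚ.≤ size ℚ.* μ

  -- The value of γ in terms of the largest mean distance.

  module _ {μ} (M : MaxMeanDistance μ) where
    open MaxMeanDistance M

    private
      1≤N : 1ℚ ℚ.≤ size
      1≤N = 1≤size far

      0<N : 0ℚ ℚ.< size
      0<N = ℚ.<-≤-trans (ℚ.positive⁻¹ 1ℚ) 1≤N

    -- The triangle inequality at u, v, v says that 0 is at most twice `d u v`.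
    d-nonNeg : ∀ u v → 0ℚ ℚ.≤ d u v
    d-nonNeg u v = 0≤p+p⇒0≤p (subst (ℚ._≤ d u v ℚ.+ d u v) (d-refl v) (triangle u v v))

    -- Taking the common point of `triangle` to be v leaves `d v u` plus the vanishing `d v v`.
    -- Symmetry is therefore no field of the record.
    d-sym-≤ : ∀ u v → d u v ℚ.≤ d v u
    d-sym-≤ u v = subst (d u v ℚ.≤_)
      (trans (cong (d v u ℚ.+_) (d-refl v)) (ℚ.+-identityʳ (d v u))) (triangle v u v)

    triangle′ : ∀ u v w → d u v ℚ.≤ d u w ℚ.+ d v w
    triangle′ u v w = ℚ.≤-trans (triangle w u v) (ℚ.+-mono-≤ (d-sym-≤ w u) (d-sym-≤ w v))

    d-nonexpansive : ∀ w {u v} → u ∼ v → ℚ.∣ d w u ℚ.- d w v ∣ ℚ.≤ 1ℚ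
    d-nonexpansive w {u} {v} u∼v = p-q≤r⇒∣p-q∣≤r {d w u}
      (p≤q+r⇒p-q≤r {d w u} (half u∼v)) (p≤q+r⇒p-q≤r {d w v} (half (∼-sym u∼v)))
      where
      half : ∀ {u v} → u ∼ v → d w u ℚ.≤ d w v ℚ.+ 1ℚ
      half {u} {v} u∼v = ℚ.≤-trans (triangle′ w u v) (ℚ.+-monoʳ-≤ (d w v) (adjacent u∼v))

    -- Sum `triangle′ far v u` over u, bound both totals by `total≤` and cancel `size`. This gives
    -- the upper half of `∣cone∣≤1`.
    d-far≤ : ∀ v → d far v ℚ.≤ μ ℚ.+ μ
    d-far≤ v = ℚ.*-cancelˡ-≤-pos size {{ℚ.positive 0<N}} (ℚ.≤-trans
      (subst₂ ℚ._≤_ (total-const (d far v)) (total-+ (d far) (d v))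
        (total-mono (λ _ → d far v) (λ u → d far u ℚ.+ d v u) (triangle′ far v)))
      (subst (total (d far) ℚ.+ total (d v) ℚ.≤_) (sym (ℚ.*-distribˡ-+ size μ μ))
        (ℚ.+-mono-≤ (total≤ far) (total≤ v))))

    -- Summing f v - f u over u bounds f v up to the mean of f.
    ∣f∣≤∣total∣+ : ∀ (f : V G → ℚ) c → 0ℚ ℚ.≤ c →
                   (∀ {u v} → u ∼ v → ℚ.∣ f u ℚ.- f v ∣ ℚ.≤ c) →
                   ∀ v → ℚ.∣ f v ∣ ℚ.≤ ℚ.∣ total f ∣ ℚ.+ c ℚ.* μ
    ∣f∣≤∣total∣+ f c 0≤c f-lip v = ℚ.*-cancelˡ-≤-pos size {{ℚ.positive 0<N}} (begin
      size ℚ.* ℚ.∣ f v ∣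
        ≡⟨ cong (ℚ._* ℚ.∣ f v ∣) (ℚ.0≤p⇒∣p∣≡p (ℚ.<⇒≤ 0<N)) ⟨
      ℚ.∣ size ∣ ℚ.* ℚ.∣ f v ∣
        ≡⟨ ℚ.∣p*q∣≡∣p∣*∣q∣ size (f v) ⟨
      ℚ.∣ size ℚ.* f v ∣
        ≡⟨ cong ℚ.∣_∣ deviation ⟩
      ℚ.∣ total (λ u → f v ℚ.- f u) ℚ.+ total f ∣
        ≤⟨ ℚ.∣p+q∣≤∣p∣+∣q∣ (total (λ u → f v ℚ.- f u)) (total f) ⟩
      ℚ.∣ total (λ u → f v ℚ.- f u) ∣ ℚ.+ ℚ.∣ total f ∣
        ≤⟨ ℚ.+-mono-≤ deviation≤ total≤size*total ⟩
      c ℚ.* (size ℚ.* μ) ℚ.+ size ℚ.* ℚ.∣ total f ∣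
        ≡⟨ solve 4 (λ c n μ t → c :* (n :* μ) :+ n :* t := n :* (t :+ c :* μ))
             refl c size μ ℚ.∣ total f ∣ ⟩
      size ℚ.* (ℚ.∣ total f ∣ ℚ.+ c ℚ.* μ) ∎)
      where
      open ℚ.≤-Reasoning

      deviation : size ℚ.* f v ≡ total (λ u → f v ℚ.- f u) ℚ.+ total f
      deviation = trans (sym (total-const (f v)))
        (trans (total-cong (λ _ → f v) (λ u → (f v ℚ.- f u) ℚ.+ f u) λ u →
            solve 2 (λ p q → p := (p :- q) :+ q) refl (f v) (f u))
          (total-+ (λ u → f v ℚ.- f u) f))

      deviation≤ : ℚ.∣ total (λ u → f v ℚ.- f u) ∣ ℚ.≤ c ℚ.* (size ℚ.* μ)
      deviation≤ = begin
        ℚ.∣ total (λ u → f v ℚ.- f u) ∣       ≤⟨ ∣total∣≤ (λ u → f v ℚ.- f u) ⟩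
        total (λ u → ℚ.∣ f v ℚ.- f u ∣)
          ≤⟨ total-mono (λ u → ℚ.∣ f v ℚ.- f u ∣) (λ u → c ℚ.* d v u) (lipschitz f c f-lip v) ⟩
        total (λ u → c ℚ.* d v u)             ≡⟨ total-* c (d v) ⟩
        c ℚ.* total (d v)                     ≤⟨ ℚ.*-monoˡ-≤-nonNeg c {{ℚ.nonNegative 0≤c}} (total≤ v) ⟩
        c ℚ.* (size ℚ.* μ)                    ∎

      -- The sharp error term would be the mean of f. As `size` is at least 1, the coarser `total f`
      -- may replace it; for members of `ℱ` it becomes arbitrarily small.
      total≤size*total : ℚ.∣ total f ∣ ℚ.≤ size ℚ.* ℚ.∣ total f ∣
      total≤size*total = subst (ℚ._≤ size ℚ.* ℚ.∣ total f ∣) (ℚ.*-identityˡ ℚ.∣ total f ∣)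
        (ℚ.*-monoʳ-≤-nonNeg ℚ.∣ total f ∣ {{ℚ.∣-∣-nonNeg (total f)}} 1≤N)

    module _ (0<μ : 0ℚ ℚ.< μ) where
      -- At a single index the sum is 0 and the norm is 1 only approximately, so the estimate is
      -- made there with tolerance δ. It is scaled by μ, which is cancelled afterwards.
      recip≤γ : ∀ x → ℱ x → fromℚ (recip μ) ≤ γ[ x ]
      recip≤γ x (sum≃0 , norm≃1) ε 0<ε =
        -- One error δ comes from the sum and one from the norm; together they may cost ε μ.
        let δ     = ½ ℚ.* (ε ℚ.* μ)
            0<δ   = half-pos (*-pos 0<ε 0<μ)
            A , f = sum≃0 δ 0<δ
            B , g = ≃⇒≤ {1ℝ} {‖ x ‖∞} (≃-sym {‖ x ‖∞} {1ℝ} norm≃1) δ 0<δ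
        in A ℕ.⊔ B , λ n A⊔B≤n →
          ℚ.*-cancelʳ-<-nonNeg μ {{ℚ.nonNegative (ℚ.<⇒≤ 0<μ)}}
            (bound n (f n (ℕ.m⊔n≤o⇒m≤o A B A⊔B≤n)) (g n (ℕ.m⊔n≤o⇒n≤o A B A⊔B≤n)))
        where
        bound : ∀ n → let δ = ½ ℚ.* (ε ℚ.* μ) in
                ℚ.∣ seq (sum (map x vertices)) n ℚ.- 0ℚ ∣ ℚ.< δ →
                1ℚ ℚ.< seq ‖ x ‖∞ n ℚ.+ δ →
                recip μ ℚ.* μ ℚ.< (seq γ[ x ] n ℚ.+ ε) ℚ.* μ
        bound n sum<δ 1<norm+δ = begin-strict
          recip μ ℚ.* μ
            ≡⟨ trans (ℚ.*-comm (recip μ) μ) (*-recip 0<μ) ⟩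
          1ℚ
            <⟨ 1<norm+δ ⟩
          seq ‖ x ‖∞ n ℚ.+ δ
            ≤⟨ ℚ.+-monoˡ-≤ δ norm≤ ⟩
          (ℚ.∣ total f ∣ ℚ.+ c ℚ.* μ) ℚ.+ δ
            <⟨ ℚ.+-monoˡ-< δ (ℚ.+-monoˡ-< (c ℚ.* μ) total<δ) ⟩
          (δ ℚ.+ c ℚ.* μ) ℚ.+ δ
            ≡⟨ solve 2 (λ δ e → (δ :+ e) :+ δ := (δ :+ δ) :+ e) refl δ (c ℚ.* μ) ⟩
          (δ ℚ.+ δ) ℚ.+ c ℚ.* μ
            ≡⟨ cong (ℚ._+ c ℚ.* μ) (halves (ε ℚ.* μ)) ⟩
          ε ℚ.* μ ℚ.+ c ℚ.* μ
            ≡⟨ solve 3 (λ e c μ → e :* μ :+ c :* μ := (c :+ e) :* μ) refl ε c μ ⟩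
          (c ℚ.+ ε) ℚ.* μ ∎
          where
          open ℚ.≤-Reasoning
          δ = ½ ℚ.* (ε ℚ.* μ)
          c = seq γ[ x ] n

          f : V G → ℚ
          f v = seq (x v) n

          ∣f∣≤ : ∀ v → ℚ.∣ f v ∣ ℚ.≤ ℚ.∣ total f ∣ ℚ.+ c ℚ.* μ
          ∣f∣≤ = ∣f∣≤∣total∣+ f c (0≤γ x n) (≤-γ x n)

          norm≤ : seq ‖ x ‖∞ n ℚ.≤ ℚ.∣ total f ∣ ℚ.+ c ℚ.* μ
          norm≤ = norm-≤ x n (ℚ.≤-trans (ℚ.0≤∣p∣ (f far)) (∣f∣≤ far)) ∣f∣≤

          total<δ : ℚ.∣ total f ∣ ℚ.< δ
          total<δ = subst (λ s → ℚ.∣ s ∣ ℚ.< δ)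
            (trans (ℚ.+-identityʳ _) (seq-sum x (Inverse.from finite) n)) sum<δ

      -- The point of ℱ that grows as fast as possible away from the value -1 at far.
      cone : V G → ℚ
      cone v = recip μ ℚ.* d far v ℚ.- 1ℚ

      private
        m : ℚ
        m = recip μ

        0≤m : 0ℚ ℚ.≤ m
        0≤m = ℚ.<⇒≤ (recip-pos 0<μ)

      total-cone : total cone ≡ 0ℚ
      total-cone = begin-equality
        total cone
          ≡⟨ total-+ (λ v → m ℚ.* d far v) (λ _ → ℚ.- 1ℚ) ⟩
        total (λ v → m ℚ.* d far v) ℚ.+ total (λ _ → ℚ.- 1ℚ)
          ≡⟨ cong₂ ℚ._+_ (total-* m (d far)) (total-const (ℚ.- 1ℚ)) ⟩
        m ℚ.* total (d far) ℚ.+ size ℚ.* ℚ.- 1ℚ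
          ≡⟨ cong (λ t → m ℚ.* t ℚ.+ size ℚ.* ℚ.- 1ℚ) total-far ⟩
        m ℚ.* (size ℚ.* μ) ℚ.+ size ℚ.* ℚ.- 1ℚ
          ≡⟨ solve 3 (λ m n μ → m :* (n :* μ) :+ n :* (:- con 1ℚ) := n :* (μ :* m :- con 1ℚ))
               refl m size μ ⟩
        size ℚ.* (μ ℚ.* m ℚ.- 1ℚ)
          ≡⟨ cong (λ t → size ℚ.* (t ℚ.- 1ℚ)) (*-recip 0<μ) ⟩
        size ℚ.* 0ℚ
          ≡⟨ ℚ.*-zeroʳ size ⟩
        0ℚ ∎
        where open ℚ.≤-Reasoning

      -- The scaled distance lies between 0, by `d-nonNeg`, and 2, by `d-far≤`; subtracting 1
      -- centres this range.
      ∣cone∣≤1 : ∀ v → ℚ.∣ cone v ∣ ℚ.≤ 1ℚ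
      ∣cone∣≤1 v = p-q≤r⇒∣p-q∣≤r {m ℚ.* d far v} {1ℚ}
        (p≤q+r⇒p-q≤r {m ℚ.* d far v} {1ℚ} (subst (m ℚ.* d far v ℚ.≤_)
          (trans (solve 2 (λ m μ → m :* (μ :+ μ) := μ :* m :+ μ :* m) refl m μ)
            (cong (λ t → t ℚ.+ t) (*-recip 0<μ)))
          (ℚ.*-monoˡ-≤-nonNeg m {{ℚ.nonNegative 0≤m}} (d-far≤ v))))
        (p≤q+r⇒p-q≤r {1ℚ} {m ℚ.* d far v} (subst (ℚ._≤ m ℚ.* d far v ℚ.+ 1ℚ) (ℚ.+-identityˡ 1ℚ)
          (ℚ.+-monoˡ-≤ 1ℚ (subst (ℚ._≤ m ℚ.* d far v) (ℚ.*-zeroʳ m)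
            (ℚ.*-monoˡ-≤-nonNeg m {{ℚ.nonNegative 0≤m}} (d-nonNeg far v))))))

      cone-far : cone far ≡ ℚ.- 1ℚ
      cone-far = cong (ℚ._- 1ℚ) (trans (cong (m ℚ.*_) (d-refl far)) (ℚ.*-zeroʳ m))

      cone∈ℱ : ℱ (fromℚ ∘ cone)
      cone∈ℱ =
        ≃-pointwise {sum (map (fromℚ ∘ cone) vertices)} {0ℝ} (λ n →
          trans (seq-sum (fromℚ ∘ cone) (Inverse.from finite) n) total-cone) ,
        ≃-pointwise {‖ fromℚ ∘ cone ‖∞} {1ℝ} (λ n → ℚ.≤-antisym
          (norm-≤ (fromℚ ∘ cone) n {1ℚ} (ℚ.nonNegative⁻¹ 1ℚ) ∣cone∣≤1)
          -- The norm reaches 1 at `far`, where the cone has value -1.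
          (subst (ℚ._≤ seq ‖ fromℚ ∘ cone ‖∞ n) (cong ℚ.∣_∣ cone-far)
            (≤-norm (fromℚ ∘ cone) n far)))

      ∣cone-cone∣≤ : ∀ {u v} → u ∼ v → ℚ.∣ cone u ℚ.- cone v ∣ ℚ.≤ m
      ∣cone-cone∣≤ {u} {v} u∼v = begin
        ℚ.∣ cone u ℚ.- cone v ∣
          ≡⟨ cong ℚ.∣_∣ (solve 3
               (λ m p q → (m :* p :- con 1ℚ) :- (m :* q :- con 1ℚ) := m :* (p :- q)) refl
               m (d far u) (d far v)) ⟩
        ℚ.∣ m ℚ.* (d far u ℚ.- d far v) ∣
          ≡⟨ ℚ.∣p*q∣≡∣p∣*∣q∣ m (d far u ℚ.- d far v) ⟩
        ℚ.∣ m ∣ ℚ.* ℚ.∣ d far u ℚ.- d far v ∣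
          ≡⟨ cong (ℚ._* ℚ.∣ d far u ℚ.- d far v ∣) (ℚ.0≤p⇒∣p∣≡p 0≤m) ⟩
        m ℚ.* ℚ.∣ d far u ℚ.- d far v ∣
          ≤⟨ ℚ.*-monoˡ-≤-nonNeg m {{ℚ.nonNegative 0≤m}} (d-nonexpansive far u∼v) ⟩
        m ℚ.* 1ℚ
          ≡⟨ ℚ.*-identityʳ m ⟩
        m ∎
        where open ℚ.≤-Reasoning

      isγ : Isγ G (fromℚ (recip μ))
      isγ =
        (fromℚ ∘ cone , cone∈ℱ , ≤-antisym {γ[ fromℚ ∘ cone ]} {fromℚ m}
          (≤-pointwise {γ[ fromℚ ∘ cone ]} {fromℚ m} λ n →
            γ-≤ (fromℚ ∘ cone) n {m} 0≤m ∣cone-cone∣≤)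
          -- The cone is itself in `ℱ`, so the general lower bound applies to it and shows that it
          -- is attained.
          (recip≤γ (fromℚ ∘ cone) cone∈ℱ)) ,
        recip≤γ

-- Cartesian products

module _ {k} (G : Fin (suc k) → Graph) where
  private
    G₀ = G zero
    G₊ = □ (G ∘ suc)
    module G  = Graph (□ G)
    module G₀ = Graph G₀
    module G₊ = Graph G₊

  tail-adjacent : ∀ {a b u v i} → AdjacentAt G (a , u) (b , v) (suc i) →
                  AdjacentAt (G ∘ suc) u v i
  tail-adjacent (i∼ , i=) = i∼ , λ j j≢i → i= (suc j) (j≢i ∘ Fin.suc-injective)

  cons-adjacent : ∀ a {u v i} → AdjacentAt (G ∘ suc) u v i →
                  AdjacentAt G (a , u) (a , v) (suc i)
  cons-adjacent a (i∼ , i=) = i∼ , λ where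
    zero    _   → refl
    (suc j) j≢i → i= j (j≢i ∘ cong suc)

  head-edge : ∀ {a b} u → a G₀.∼ b → (a , u) G.∼ (b , u)
  head-edge {a} {b} u a∼b = zero , (a∼b , same) , only
    where
    same : ∀ j → j ≢ zero → _!_ {A = V ∘ G} (a , u) j ≡ _!_ {A = V ∘ G} (b , u) j
    same zero    0≢0 = contradiction refl 0≢0
    same (suc j) _   = refl

    -- At every other index the coordinates agree, so adjacency there would be a loop.
    only : ∀ {j} → AdjacentAt G (a , u) (b , u) j → zero ≡ j
    only {zero}  _        = refl
    only {suc j} (j∼ , _) = contradiction j∼ (Graph.∼-irr (G (suc j)))

  tail-edge : ∀ a {u v} → u G₊.∼ v → (a , u) G.∼ (a , v)
  tail-edge a {u} {v} (i , at , i!) = suc i , cons-adjacent a at , only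
    where
    only : ∀ {j} → AdjacentAt G (a , u) (a , v) j → suc i ≡ j
    only {zero}  (0∼ , _) = contradiction 0∼ G₀.∼-irr
    only {suc j} at′      = cong suc (i! (tail-adjacent at′))

  -- The enumeration of `□ G` is `remQuot` followed by the enumerations of the head and of the
  -- product of the tail.
  total-□ : ∀ f → total (□ G) f ≡ total G₀ (λ a → total G₊ (λ u → f (a , u)))
  total-□ f = sum-remQuot (order G₀)
    (λ (i , j) → f (Inverse.from G₀.finite i , Inverse.from G₊.finite j))

  size-□ : size (□ G) ≡ size G₀ ℚ.* size G₊
  size-□ = Mult.×1-homo-* (order G₀) (order G₊)

!-ext : ∀ {k} {A : Fin k → Set} {u v : Tuple A} → (∀ i → _!_ {A = A} u i ≡ _!_ {A = A} v i) → u ≡ v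
!-ext {zero}  u≡v = refl
!-ext {suc k} u≡v = cong₂ _,_ (u≡v zero) (!-ext (u≡v ∘ suc))

module _ {k} (G : Fin (suc k) → Graph) {μ₀ μ₊}
  (M₀ : MaxMeanDistance (G zero) μ₀) (M₊ : MaxMeanDistance (□ (G ∘ suc)) μ₊) where
  private
    G₀ = G zero
    G₊ = □ (G ∘ suc)
    module G  = Graph (□ G)
    module M₀ = MaxMeanDistance M₀
    module M₊ = MaxMeanDistance M₊

  □-d : V (□ G) → V (□ G) → ℚ
  □-d (a , u) (b , v) = M₀.d a b ℚ.+ M₊.d u v

  □-triangle : ∀ u v w → □-d v w ℚ.≤ □-d u v ℚ.+ □-d u w
  □-triangle (a , u) (b , v) (c , w) = subst (M₀.d b c ℚ.+ M₊.d v w ℚ.≤_)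
    (solve 4 (λ p q r s → (p :+ q) :+ (r :+ s) := (p :+ r) :+ (q :+ s)) refl
      (M₀.d a b) (M₀.d a c) (M₊.d u v) (M₊.d u w))
    (ℚ.+-mono-≤ (M₀.triangle a b c) (M₊.triangle u v w))

  -- Along an edge only one component moves, by an edge of its own factor. The other component is
  -- replaced by its equal, so its distance vanishes by `d-refl`.
  □-adjacent : ∀ {u v} → u G.∼ v → □-d u v ℚ.≤ 1ℚ
  □-adjacent {a , u} {b , v} (zero , (a∼b , same) , _) =
    subst (λ v → M₀.d a b ℚ.+ M₊.d u v ℚ.≤ 1ℚ) (!-ext λ j → same (suc j) λ ())
      (subst (ℚ._≤ 1ℚ)
        (sym (trans (cong (M₀.d a b ℚ.+_) (M₊.d-refl u)) (ℚ.+-identityʳ (M₀.d a b))))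
        (M₀.adjacent a∼b))
  □-adjacent {a , u} {b , v} (suc i , at , i!) =
    subst (λ b → M₀.d a b ℚ.+ M₊.d u v ℚ.≤ 1ℚ) (proj₂ at zero λ ())
      (subst (ℚ._≤ 1ℚ)
        (sym (trans (cong (ℚ._+ M₊.d u v) (M₀.d-refl a)) (ℚ.+-identityˡ (M₊.d u v))))
        (M₊.adjacent (i , tail-adjacent G at , λ at′ → Fin.suc-injective (i! (lift at′)))))
    where
    -- Uniqueness of the moving index is known for whole tuples; an adjacency of tails is lifted to
    -- them using the equality of the heads.
    lift : ∀ {j} → AdjacentAt (G ∘ suc) u v j → AdjacentAt G (a , u) (b , v) (suc j)
    lift at′ = subst (λ b → AdjacentAt G (a , u) (b , v) (suc _)) (proj₂ at zero λ ())
      (cons-adjacent G a at′)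

  -- Pass through `(b , u)`: the first leg stays in a copy of the head factor, the second in a copy
  -- of the product of the tail.
  □-lipschitz : ∀ (f : V (□ G) → ℚ) c → (∀ {u v} → u G.∼ v → ℚ.∣ f u ℚ.- f v ∣ ℚ.≤ c) →
                ∀ u v → ℚ.∣ f u ℚ.- f v ∣ ℚ.≤ c ℚ.* □-d u v
  □-lipschitz f c f-lip (a , u) (b , v) = begin
    ℚ.∣ f (a , u) ℚ.- f (b , v) ∣
      ≡⟨ cong ℚ.∣_∣ (solve 3 (λ p q r → p :- r := (p :- q) :+ (q :- r)) refl
           (f (a , u)) (f (b , u)) (f (b , v))) ⟩
    ℚ.∣ (f (a , u) ℚ.- f (b , u)) ℚ.+ (f (b , u) ℚ.- f (b , v)) ∣
      ≤⟨ ℚ.∣p+q∣≤∣p∣+∣q∣ (f (a , u) ℚ.- f (b , u)) (f (b , u) ℚ.- f (b , v)) ⟩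
    ℚ.∣ f (a , u) ℚ.- f (b , u) ∣ ℚ.+ ℚ.∣ f (b , u) ℚ.- f (b , v) ∣
      ≤⟨ ℚ.+-mono-≤
           (M₀.lipschitz (λ a → f (a , u)) c (λ a∼b → f-lip (head-edge G u a∼b)) a b)
           (M₊.lipschitz (λ u → f (b , u)) c (λ u∼v → f-lip (tail-edge G b u∼v)) u v) ⟩
    c ℚ.* M₀.d a b ℚ.+ c ℚ.* M₊.d u v
      ≡⟨ ℚ.*-distribˡ-+ c (M₀.d a b) (M₊.d u v) ⟨
    c ℚ.* (M₀.d a b ℚ.+ M₊.d u v) ∎
    where open ℚ.≤-Reasoning

  -- Each summand of `□-d` is constant along the other factor, hence is counted as often as that
  -- factor has vertices.
  total-□-d : ∀ a u → total (□ G) (□-d (a , u)) ≡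
              size G₊ ℚ.* total G₀ (M₀.d a) ℚ.+ size G₀ ℚ.* total G₊ (M₊.d u)
  total-□-d a u = begin-equality
    total (□ G) (□-d (a , u))
      ≡⟨ total-□ G (□-d (a , u)) ⟩
    total G₀ (λ b → total G₊ (λ v → M₀.d a b ℚ.+ M₊.d u v))
      ≡⟨ total-cong G₀ (λ b → total G₊ (λ v → M₀.d a b ℚ.+ M₊.d u v))
           (λ b → size G₊ ℚ.* M₀.d a b ℚ.+ total G₊ (M₊.d u)) (λ b →
           trans (total-+ G₊ (λ _ → M₀.d a b) (M₊.d u))
             (cong (ℚ._+ total G₊ (M₊.d u)) (total-const G₊ (M₀.d a b)))) ⟩
    total G₀ (λ b → size G₊ ℚ.* M₀.d a b ℚ.+ total G₊ (M₊.d u))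
      ≡⟨ total-+ G₀ (λ b → size G₊ ℚ.* M₀.d a b) (λ _ → total G₊ (M₊.d u)) ⟩
    total G₀ (λ b → size G₊ ℚ.* M₀.d a b) ℚ.+ total G₀ (λ _ → total G₊ (M₊.d u))
      ≡⟨ cong₂ ℚ._+_ (total-* G₀ (size G₊) (M₀.d a)) (total-const G₀ (total G₊ (M₊.d u))) ⟩
    size G₊ ℚ.* total G₀ (M₀.d a) ℚ.+ size G₀ ℚ.* total G₊ (M₊.d u) ∎
    where open ℚ.≤-Reasoning

  private
    size-*-μ : size G₊ ℚ.* (size G₀ ℚ.* μ₀) ℚ.+ size G₀ ℚ.* (size G₊ ℚ.* μ₊) ≡
               size (□ G) ℚ.* (μ₀ ℚ.+ μ₊)
    size-*-μ = trans
      (solve 4 (λ m n p q → n :* (m :* p) :+ m :* (n :* q) := (m :* n) :* (p :+ q)) refl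
        (size G₀) (size G₊) μ₀ μ₊)
      (cong (ℚ._* (μ₀ ℚ.+ μ₊)) (sym (size-□ G)))

  -- By `total-□-d` the total splits into one term per component. The terms can be maximised
  -- independently, so a pair of far vertices is far.
  □-maxMeanDistance : MaxMeanDistance (□ G) (μ₀ ℚ.+ μ₊)
  □-maxMeanDistance = record
    { d         = □-d
    ; d-refl    = λ (a , u) → cong₂ ℚ._+_ (M₀.d-refl a) (M₊.d-refl u)
    ; triangle  = □-triangle
    ; adjacent  = λ {u} {v} → □-adjacent {u} {v}
    ; lipschitz = □-lipschitz
    ; far       = M₀.far , M₊.far
    ; total-far = trans (total-□-d M₀.far M₊.far)
        (trans (cong₂ (λ p q → size G₊ ℚ.* p ℚ.+ size G₀ ℚ.* q) M₀.total-far M₊.total-far)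
          size-*-μ)
    ; total≤    = λ (a , u) → subst₂ ℚ._≤_ (sym (total-□-d a u)) size-*-μ
        (ℚ.+-mono-≤
          (ℚ.*-monoˡ-≤-nonNeg (size G₊) {{ℚ.nonNegative (0≤fromℕ (order G₊))}} (M₀.total≤ a))
          (ℚ.*-monoˡ-≤-nonNeg (size G₀) {{ℚ.nonNegative (0≤fromℕ (order G₀))}} (M₊.total≤ u)))
    }

∏-maxMeanDistance : ∀ {k} (G : Fin k → Graph) {μ : Fin k → ℚ} →
                    (∀ i → MaxMeanDistance (G i) (μ i)) →
                    MaxMeanDistance (□ G) (∑.sum μ)
-- The empty product is a single vertex with mean distance 0, the empty sum. The record can hold it
-- since positivity of μ is asked only later, for `isγ`.
∏-maxMeanDistance {zero} G M = record
  { d         = λ _ _ → 0ℚ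
  ; d-refl    = λ _ → refl
  ; triangle  = λ _ _ _ → ℚ.≤-refl
  ; adjacent  = λ ()
  ; lipschitz = λ f c _ _ _ → ℚ.≤-reflexive
      (trans (cong ℚ.∣_∣ (ℚ.+-inverseʳ (f tt))) (sym (ℚ.*-zeroʳ c)))
  ; far       = tt
  ; total-far = refl
  ; total≤    = λ _ → ℚ.≤-refl
  }
∏-maxMeanDistance {suc k} G M =
  □-maxMeanDistance G (M zero) (∏-maxMeanDistance (G ∘ suc) (M ∘ suc))

-- Shortest walks

-- Linear search upwards from 0 through shifted predicates; the given n bounds its length.
least : ∀ {P : ℕ → Set} → (∀ n → Dec (P n)) → ∀ {n} → P n → ∃ λ m → P m × (∀ {k} → P k → m ℕ.≤ k)
least P? {n} Pn with P? 0
least P? {n}     Pn | yes P0 = 0 , P0 , λ _ → z≤n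
least P? {zero}  Pn | no ¬P0 = contradiction Pn ¬P0
least {P} P? {suc n} Pn | no ¬P0 =
  let m , Pm , m≤ = least (P? ∘ suc) {n} Pn
  in suc m , Pm , minimal m≤
  where
  minimal : ∀ {m} → (∀ {k} → P (suc k) → m ℕ.≤ k) → ∀ {k} → P k → suc m ℕ.≤ k
  minimal m≤ {zero}  P0 = contradiction P0 ¬P0
  minimal m≤ {suc k} Pk = s≤s (m≤ Pk)

module _ (G : Graph) (connected : Connected G) where
  open Graph G hiding (V; order; Connected; Isγ)

  -- Recursion on the length lets `walk?` decide existence by trying each vertex as the next one.
  Walk : ℕ → V G → V G → Set
  Walk zero    u v = u ≡ v
  Walk (suc n) u v = ∃ λ w → u ∼ w × Walk n w v

  walk? : ∀ u v n → Dec (Walk n u v)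
  walk? u v zero    = u ≟ v
  walk? u v (suc n) = map′
    (λ (i , walk) → Inverse.from finite i , walk)
    (λ (w , walk) → Inverse.to finite w ,
      subst (λ w → u ∼ w × Walk n w v) (sym (Inverse.strictlyInverseʳ finite w)) walk)
    (Fin.any? λ i → (u ∼? Inverse.from finite i) ×-dec walk? (Inverse.from finite i) v n)

  walk-++ : ∀ m {n u v w} → Walk m u v → Walk n v w → Walk (m ℕ.+ n) u w
  walk-++ zero    refl            q = q
  walk-++ (suc m) (_ , u∼ , p) q = _ , u∼ , walk-++ m p q

  walk-reverse : ∀ n {u v} → Walk n u v → Walk n v u
  walk-reverse zero    refl                = refl
  -- The reversed first edge is appended at the end, which gives length `n + 1` instead of `suc n`.
  walk-reverse (suc n) {u} {v} (w , u∼w , p) = subst (λ m → Walk m v u) (ℕ.+-comm n 1)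
    (walk-++ n {1} (walk-reverse n p) (u , ∼-sym u∼w , refl))

  star⇒walk : ∀ {u v} → Star _∼_ u v → ∃ λ n → Walk n u v
  star⇒walk Star.ε   = 0 , refl
  star⇒walk (u∼ ◅ p) = let n , q = star⇒walk p in suc n , _ , u∼ , q

  walk-lipschitz : ∀ (f : V G → ℚ) c → (∀ {u v} → u ∼ v → ℚ.∣ f u ℚ.- f v ∣ ℚ.≤ c) →
                   ∀ n {u v} → Walk n u v → ℚ.∣ f u ℚ.- f v ∣ ℚ.≤ c ℚ.* fromℕ n
  walk-lipschitz f c f-lip zero {u} refl = ℚ.≤-reflexive
    (trans (cong ℚ.∣_∣ (ℚ.+-inverseʳ (f u))) (sym (ℚ.*-zeroʳ c)))
  walk-lipschitz f c f-lip (suc n) {u} {v} (w , u∼w , p) = begin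
    ℚ.∣ f u ℚ.- f v ∣
      ≡⟨ cong ℚ.∣_∣ (solve 3 (λ p q r → p :- r := (p :- q) :+ (q :- r)) refl (f u) (f w) (f v)) ⟩
    ℚ.∣ (f u ℚ.- f w) ℚ.+ (f w ℚ.- f v) ∣
      ≤⟨ ℚ.∣p+q∣≤∣p∣+∣q∣ (f u ℚ.- f w) (f w ℚ.- f v) ⟩
    ℚ.∣ f u ℚ.- f w ∣ ℚ.+ ℚ.∣ f w ℚ.- f v ∣
      ≤⟨ ℚ.+-mono-≤ (f-lip u∼w) (walk-lipschitz f c f-lip n p) ⟩
    c ℚ.+ c ℚ.* fromℕ n
      ≡⟨ cong (ℚ._+ c ℚ.* fromℕ n) (ℚ.*-identityʳ c) ⟨
    c ℚ.* 1ℚ ℚ.+ c ℚ.* fromℕ n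
      ≡⟨ ℚ.*-distribˡ-+ c 1ℚ (fromℕ n) ⟨
    c ℚ.* fromℕ (suc n) ∎
    where open ℚ.≤-Reasoning

  -- Connectedness supplies one walk, whose length bounds the search for the least one.
  shortest : ∀ u v → ∃ λ n → Walk n u v × (∀ {m} → Walk m u v → n ℕ.≤ m)
  shortest u v = least (walk? u v) (proj₂ (star⇒walk (connected u v)))

  dist : V G → V G → ℕ
  dist u v = proj₁ (shortest u v)

  dist-walk : ∀ u v → Walk (dist u v) u v
  dist-walk u v = proj₁ (proj₂ (shortest u v))

  dist≤ : ∀ {u v} n → Walk n u v → dist u v ℕ.≤ n
  dist≤ {u} {v} n p = proj₂ (proj₂ (shortest u v)) p

  dist-pos : ∀ {u v} → u ≢ v → 0 ℕ.< dist u v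
  dist-pos {u} {v} u≢v with dist u v | dist-walk u v
  ... | zero  | u≡v = contradiction u≡v u≢v
  ... | suc n | _   = s≤s z≤n

  -- Follow a shortest walk from u to v backwards, then one from u to w.
  dist-triangle : ∀ u v w → dist v w ℕ.≤ dist u v ℕ.+ dist u w
  dist-triangle u v w = dist≤ (dist u v ℕ.+ dist u w)
    (walk-++ (dist u v) (walk-reverse (dist u v) (dist-walk u v)) (dist-walk u w))

  -- The largest mean distance of a connected graph.

  transmission : V G → ℚ
  transmission u = total G (λ v → fromℕ (dist u v))

  -- The argument v is the default that `argmax` demands. As `vertices` lists every vertex, the
  -- maximum is global for any v.
  farthest : V G → V G
  farthest v = argmax transmission v vertices

  transmission≤ : ∀ v u → transmission u ℚ.≤ transmission (farthest v)
  transmission≤ v u = All.lookup (f[xs]≤f[argmax] v vertices) (∈-vertices G u)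

  module _ (v₀ : V G) where
    private
      0<size : 0ℚ ℚ.< size G
      0<size = ℚ.<-≤-trans (ℚ.positive⁻¹ 1ℚ) (1≤size G v₀)

    maxMean : ℚ
    maxMean = recip (size G) ℚ.* transmission (farthest v₀)

    private
      size*maxMean : size G ℚ.* maxMean ≡ transmission (farthest v₀)
      size*maxMean = trans (sym (ℚ.*-assoc (size G) (recip (size G)) _))
        (trans (cong (ℚ._* transmission (farthest v₀)) (*-recip 0<size)) (ℚ.*-identityˡ _))

    maxMeanDistance : MaxMeanDistance G maxMean
    maxMeanDistance = record
      { d         = λ u v → fromℕ (dist u v)
      ; d-refl    = λ v → cong fromℕ (ℕ.n≤0⇒n≡0 (dist≤ {v} 0 refl))
      ; triangle  = λ u v w → subst (fromℕ (dist v w) ℚ.≤_)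
          (Mult.×-homo-+ 1ℚ (dist u v) (dist u w)) (fromℕ-mono (dist-triangle u v w))
      ; adjacent  = λ u∼v → fromℕ-mono {n = 1} (dist≤ 1 (_ , u∼v , refl))
      ; lipschitz = λ f c f-lip u v → walk-lipschitz f c f-lip (dist u v) (dist-walk u v)
      ; far       = farthest v₀
      ; total-far = sym size*maxMean
      ; total≤    = λ u → subst (transmission u ℚ.≤_) (sym size*maxMean) (transmission≤ v₀ u)
      }

    -- A second vertex adds at least 1 to the transmission of `v₀`, which the maximal transmission
    -- dominates.
    maxMean-pos : ∀ i → v₀ ≢ Inverse.from finite i → 0ℚ ℚ.< maxMean
    maxMean-pos i v₀≢ = ℚ.*-cancelˡ-<-nonNeg (size G) {{ℚ.nonNegative (ℚ.<⇒≤ 0<size)}}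
      (subst₂ ℚ._<_ (sym (ℚ.*-zeroʳ (size G))) (sym size*maxMean)
        (ℚ.<-≤-trans (ℚ.positive⁻¹ 1ℚ)
        (ℚ.≤-trans (fromℕ-mono {1} (dist-pos v₀≢))
        (ℚ.≤-trans (term≤sum {order G} {λ i → fromℕ (dist v₀ (Inverse.from finite i))}
            (λ j → 0≤fromℕ (dist v₀ (Inverse.from finite j))) i)
          (transmission≤ v₀ v₀)))))

two-elements : ∀ {n} → 2 ℕ.≤ n → Σ[ i ∈ Fin n ] Σ[ j ∈ Fin n ] i ≢ j
two-elements (s≤s (s≤s _)) = zero , suc zero , λ ()

∃-maxMeanDistance : ∀ G → Connected G → 2 ℕ.≤ order G → ∃ λ μ → 0ℚ ℚ.< μ × MaxMeanDistance G μ
∃-maxMeanDistance G connected 2≤n =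
  let i , j , i≢j = two-elements 2≤n
      from = Inverse.from (Graph.finite G)
      to   = Inverse.to (Graph.finite G)
      to∘from = Inverse.strictlyInverseˡ (Graph.finite G)
  in maxMean G connected (from i) ,
     maxMean-pos G connected (from i) j (λ eq →
       i≢j (trans (sym (to∘from i)) (trans (cong to eq) (to∘from j)))) ,
     maxMeanDistance G connected (from i)

-- The reciprocal formula for products.

sum-pos : ∀ {k} .{{_ : NonZero k}} {μ : Fin k → ℚ} → (∀ i → 0ℚ ℚ.< μ i) → 0ℚ ℚ.< ∑.sum μ
sum-pos {suc k} 0<μ = ℚ.+-mono-<-≤ (0<μ zero) (sum-nonNeg (ℚ.<⇒≤ ∘ 0<μ ∘ suc))

recip-recip : ∀ {p} → 0ℚ ℚ.< p → recip (recip p) ≡ p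
recip-recip {p} 0<p = recip-unique {recip p} (trans (ℚ.*-comm (recip p) p) (*-recip 0<p))

theorem5p2 : ∀ (k : ℕ) .{{_ : NonZero k}} (G : Fin k → Graph) →
    (∀ i → Connected (G i)) →
    (∀ i → 2 ℕ.≤ order (G i)) →
    (∀ i → ∃ (Isγ (G i))) ×
    (∀ (γ : Fin k → ℝ) → (∀ i → Isγ (G i) (γ i)) →
    Σ[ γ≠0 ∈ (∀ i → Apart₀ (γ i)) ]
    Σ[ s≠0 ∈ Apart₀ (sum (tabulate (λ i → 1/ (γ i) (γ≠0 i)))) ]
    Isγ (□ G) (1/ (sum (tabulate (λ i → 1/ (γ i) (γ≠0 i)))) s≠0))
theorem5p2 k G connected 2≤order = (λ i → fromℚ (recip (μ i)) , isγᵢ i) , λ γ γ-min →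
  -- The given reals need not be the constructed rational ones; uniqueness of minima identifies them
  -- up to `≃`.
  let γ≃ : ∀ i → γ i ≃ fromℚ (recip (μ i))
      γ≃ i = IsMinimum-unique {f = Graph.γ[_] (G i)} {γ i} {fromℚ (recip (μ i))} (γ-min i) (isγᵢ i)

      γ≠0 : ∀ i → Apart₀ (γ i)
      γ≠0 i = ≃pos⇒apart {γ i} (γ≃ i) (recip-pos (0<μ i))

      s = sum (tabulate (λ i → 1/ (γ i) (γ≠0 i)))

      -- The reciprocal of each γ is the corresponding μ, so s is the largest mean distance of the
      -- product.
      s≃ : s ≃ fromℚ (∑.sum μ)
      s≃ = sum-tabulate-≃ λ i → subst (λ q → 1/ (γ i) (γ≠0 i) ≃ fromℚ q) (recip-recip (0<μ i))
        (1/-≃ {γ i} (γ≃ i) (recip-pos (0<μ i)) (γ≠0 i))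

      s≠0 = ≃pos⇒apart {s} s≃ (sum-pos 0<μ)
  in γ≠0 , s≠0 , IsMinimum-resp-≃ {f = Graph.γ[_] (□ G)} {fromℚ (recip (∑.sum μ))} {1/ s s≠0}
       (≃-sym {1/ s s≠0} {fromℚ (recip (∑.sum μ))} (1/-≃ {s} s≃ (sum-pos 0<μ) s≠0))
       (isγ (□ G) (∏-maxMeanDistance G M) (sum-pos 0<μ))
  where
  μ : Fin k → ℚ
  μ i = proj₁ (∃-maxMeanDistance (G i) (connected i) (2≤order i))

  0<μ : ∀ i → 0ℚ ℚ.< μ i
  0<μ i = proj₁ (proj₂ (∃-maxMeanDistance (G i) (connected i) (2≤order i)))

  M : ∀ i → MaxMeanDistance (G i) (μ i)
  M i = proj₂ (proj₂ (∃-maxMeanDistance (G i) (connected i) (2≤order i)))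

  isγᵢ : ∀ i → Isγ (G i) (fromℚ (recip (μ i)))
  isγᵢ i = isγ (G i) (M i) (0<μ i)
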